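{- Let $n\ge 2$, let $W$ be a conference matrix of order $n$, and let $k$ be an odd integer such that $k\le \sqrt{n-1}<k+2$. Then $$E(W)\le \frac{n(k^2+2k+n-1)}{2(k+1)},$$ with equality if and only if one of the following holds: (i) $n-1$ is a perfect square and $W\mathbf{1}_n=k\mathbf{1}_n$; or (ii) $n-1$ is not a perfect square and the set of entries of the vector $W\mathbf{1}_n$ is exactly $\{k,k+2\}$ (i.e. every entry is $k$ or $k+2$, and both values occur).
   Context: A conference matrix of order $n$ is an $n\times n$ matrix $W$ with entries in $\{0,-1,1\}$ and zero diagonal satisfying $WW^T=(n-1)I$, where $I$ is the $n\times n$ identity matrix. The excess $E(W)$ is the sum of all entries of $W$. $\mathbf{1}_n$ denotes the all-one column vector of length $n$. -}

module Defs where

open import Data.Bool.Base using (if_then_else_)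
open import Data.Fin.Base using (Fin)
open import Data.Fin.Properties using (_≟_)
open import Data.Integer.Base
  using (ℤ; +_; +[1+_]; -[1+_]; 0ℤ; 1ℤ; -1ℤ; _+_; _-_; _*_; _≤_; _<_; +<+)
import Data.Integer.Properties as ℤ
open import Data.Nat.Base as ℕ using (ℕ; zero; suc)
open import Data.Product using (∃; _×_; _,_)
open import Data.Rational.Base as ℚ using ()
open import Data.Rational.Literals using (fromℤ)
open import Data.Sum.Base using (_⊎_)
open import Data.Vec.Functional using (Vector; replicate; map)
open import Relation.Binary.PropositionalEquality using (_≡_; refl)
open import Relation.Nullary.Decidable using (does)
open import Relation.Unary using (Pred; _∈_; _∪_; ｛_｝)
open import Level using (0ℓ)

open import Algebra.Properties.Semiring.Sum ℤ.+-*-semiring using (sum-syntax)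

infixr 8 _ᵀ
infixl 7 _·_ _·ᵥ_
infixr 7 _•_ _•ᵥ_
infix  4 _≤√_ √_<_

Matrix : ℕ → Set
Matrix n = Fin n → Fin n → ℤ

_ᵀ : ∀ {n} → Matrix n → Matrix n
(A ᵀ) i j = A j i

_·_ : ∀ {n} → Matrix n → Matrix n → Matrix n
_·_ {n} A B i j = ∑[ l < n ] (A i l * B l j)

_·ᵥ_ : ∀ {n} → Matrix n → Vector ℤ n → Vector ℤ n
_·ᵥ_ {n} A v i = ∑[ j < n ] (A i j * v j)

I : ∀ n → Matrix n
I n i j = if does (i ≟ j) then 1ℤ else 0ℤ

_•_ : ∀ {n} → ℤ → Matrix n → Matrix n
(c • A) i j = c * A i j

_•ᵥ_ : ∀ {n} → ℤ → Vector ℤ n → Vector ℤ n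
c •ᵥ v = map (c *_) v

𝟏 : ∀ n → Vector ℤ n
𝟏 n = replicate n 1ℤ

Entries : ∀ {n} → Vector ℤ n → Pred ℤ 0ℓ
Entries v x = ∃ λ i → v i ≡ x

record IsConference {n : ℕ} (W : Matrix n) : Set where
  field
    entries      : ∀ i j → W i j ∈ ｛ 0ℤ ｝ ∪ ｛ -1ℤ ｝ ∪ ｛ 1ℤ ｝
    zeroDiagonal : ∀ i → W i i ≡ 0ℤ
    orthogonal   : ∀ i j → (W · W ᵀ) i j ≡ ((+ n - 1ℤ) • I n) i j

excess : ∀ {n} → Matrix n → ℤ
excess {n} W = ∑[ i < n ] ∑[ j < n ] W i j

Odd : ℤ → Set
Odd k = ∃ λ j → k ≡ + 2 * j + 1ℤ

PerfectSquare : ℤ → Set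
PerfectSquare m = ∃ λ r → m ≡ r * r

-- Comparison of an integer with the nonnegative real square root of m,
-- meaningful for m ≥ 0. Squaring is only monotone on nonnegative numbers,
-- hence the separate sign conditions.
_≤√_ : ℤ → ℤ → Set
k ≤√ m = k ≤ 0ℤ ⊎ k * k ≤ m

√_<_ : ℤ → ℤ → Set
√ m < l = 0ℤ < l × m < l * l

-- The denominator of the excess bound does not vanish: √(n-1) < k+2 leaves
-- only k ≥ -1, and k = -1 would force n - 1 < 1.
denominator-nonZero : ∀ {n k} → 2 ℕ.≤ n → √ (+ n - 1ℤ) < k + + 2 →
                      ℚ.NonZero (fromℤ (+ 2 * (k + 1ℤ)))
denominator-nonZero {k = + zero}        _ _ = _
denominator-nonZero {k = +[1+ _ ]}      _ _ = _
denominator-nonZero {k = -[1+ zero ]}   (ℕ.s≤s (ℕ.s≤s _)) (_ , +<+ (ℕ.s≤s ()))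
denominator-nonZero {k = -[1+ suc zero ]}    _ (+<+ () , _)
denominator-nonZero {k = -[1+ suc (suc _) ]} _ (() , _)

{-# OPTIONS --safe #-}

-- Let s = W𝟏. From WWᵀ = (n-1)I follows WᵀW = (n-1)I, hence Σ sᵢ² = n(n-1).
-- Reducing W modulo 2 shows that n is even and every sᵢ is odd, so sᵢ - k is
-- even and (sᵢ - k)(sᵢ - k - 2) ≥ 0. Summing over i gives the bound, with
-- equality exactly when every sᵢ is k or k + 2. As n-1 is odd and lies in
-- [k², (k+2)²), it is a perfect square only if it equals k²; then Σ sᵢ² = nk²
-- rules out the value k + 2. Otherwise neither value can be taken throughout,
-- as a constant s forces n-1 = s₁².

module Submission where

open import Defs
open import Data.Fin.Base using (Fin; zero; suc)
open import Data.Fin.Properties using (any?; _≟_)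
open import Data.Integer.Base
  using (ℤ; +_; +[1+_]; -[1+_]; 0ℤ; 1ℤ; ∣_∣; -_; _+_; _-_; _*_; _≤_; _<_; +≤+; +<+;
         Positive; positive; nonNegative)
open import Data.Integer.Divisibility.Signed
  using (_∣_; divides; ∣m∣n⇒∣m+n; ∣m∣n⇒∣m-n; _∣?_)
import Data.Integer.Properties as ℤ
open import Data.Integer.Tactic.RingSolver using (solve-∀)
open import Data.Nat.Base as ℕ using (ℕ)
open import Data.Product using (_×_; _,_; proj₂)
open import Data.Rational.Base as ℚ using (ℚ)
open import Data.Rational.Literals using (fromℤ)
import Data.Rational.Properties as ℚ
open import Data.Sum.Base using (_⊎_; inj₁; inj₂; [_,_]′; reduce)
open import Data.Vec.Functional using (Vector)
open import Function.Base using (_∘_; id)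
open import Function.Bundles using (_⇔_; mk⇔; Equivalence)
open import Function.Construct.Composition using (_⇔-∘_)
open import Relation.Binary.PropositionalEquality
  using (_≡_; _≢_; _≗_; refl; sym; trans; cong; cong₂; subst; subst₂; module ≡-Reasoning)
open import Relation.Nullary using (¬_; yes; no; contradiction)
open import Relation.Nullary.Decidable using (from-no)
open import Relation.Unary using (_∈_; _≐_; _∪_; ｛_｝)

open import Algebra.Properties.Semiring.Sum ℤ.+-*-semiring

open ≡-Reasoning

-- Finite sums

∑-distrib-- : ∀ {n} (f g : Vector ℤ n) → ∑[ i < n ] (f i - g i) ≡ sum f - sum g
∑-distrib-- {ℕ.zero}  f g = refl
∑-distrib-- {ℕ.suc n} f g =
  trans (cong (_+_ (f zero - g zero)) (∑-distrib-- (f ∘ suc) (g ∘ suc)))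
        (interchange (f zero) (g zero) (sum (f ∘ suc)) (sum (g ∘ suc)))
  where
  interchange : ∀ a b x y → (a - b) + (x - y) ≡ (a + x) - (b + y)
  interchange = solve-∀

∑-const : ∀ n c → ∑[ i < n ] c ≡ + n * c
∑-const ℕ.zero    c = refl
∑-const (ℕ.suc n) c =
  trans (cong (_+_ c) (∑-const n c)) (sym (ℤ.suc-* (+ n) c))

∑-nonNegative : ∀ {n} {f : Vector ℤ n} → (∀ i → 0ℤ ≤ f i) → 0ℤ ≤ sum f
∑-nonNegative {ℕ.zero}  f≥0 = ℤ.≤-refl
∑-nonNegative {ℕ.suc n} f≥0 = ℤ.+-mono-≤ (f≥0 zero) (∑-nonNegative (f≥0 ∘ suc))

nonNegative-+≡0 : ∀ {x y} → 0ℤ ≤ x → 0ℤ ≤ y → x + y ≡ 0ℤ → x ≡ 0ℤ × y ≡ 0ℤ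
nonNegative-+≡0 {+ ℕ.zero} {+ ℕ.zero} _ _ _ = refl , refl

-- This turns one identity between sums into pointwise equalities. It is applied to squares of
-- matrix entries, to the defects of a row, to differences of squared row sums and to the gaps.
∑≡0⇒≡0 : ∀ {n} {f : Vector ℤ n} → (∀ i → 0ℤ ≤ f i) → sum f ≡ 0ℤ → ∀ i → f i ≡ 0ℤ
∑≡0⇒≡0 {ℕ.suc n} f≥0 ∑f≡0 i
  with f0≡0 , rest≡0 ← nonNegative-+≡0 (f≥0 zero) (∑-nonNegative (f≥0 ∘ suc)) ∑f≡0
  with i
... | zero  = f0≡0
... | suc j = ∑≡0⇒≡0 (f≥0 ∘ suc) rest≡0 j

∣-∑ : ∀ {n d} {f : Vector ℤ n} → (∀ i → d ∣ f i) → d ∣ sum f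
∣-∑ {ℕ.zero}  d∣f = divides 0ℤ refl
∣-∑ {ℕ.suc n} d∣f = ∣m∣n⇒∣m+n (d∣f zero) (∣-∑ (d∣f ∘ suc))

square-nonNegative : ∀ x → 0ℤ ≤ x * x
square-nonNegative (+ ℕ.zero)  = ℤ.≤-refl
square-nonNegative +[1+ _ ]   = +≤+ ℕ.z≤n
square-nonNegative -[1+ _ ]   = +≤+ ℕ.z≤n

square≡0⇒≡0 : ∀ x → x * x ≡ 0ℤ → x ≡ 0ℤ
square≡0⇒≡0 x x²≡0 = reduce (ℤ.i*j≡0⇒i≡0∨j≡0 x x²≡0)

-- Matrices

I-diagonal : ∀ {n} (i : Fin n) → I n i i ≡ 1ℤ
I-diagonal zero    = refl
I-diagonal (suc i) = I-diagonal i

I-symmetric : ∀ {n} (i j : Fin n) → I n i j ≡ I n j i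
I-symmetric zero    zero    = refl
I-symmetric zero    (suc j) = refl
I-symmetric (suc i) zero    = refl
I-symmetric (suc i) (suc j) = I-symmetric i j

I·ᵥ : ∀ {n} (v : Vector ℤ n) → I n ·ᵥ v ≗ v
I·ᵥ {ℕ.suc n} v zero = begin
  1ℤ * v zero + ∑[ j < n ] (0ℤ * v (suc j))
    ≡⟨ cong₂ _+_ (ℤ.*-identityˡ (v zero)) (sum-replicate-zero n) ⟩
  v zero + 0ℤ  ≡⟨ ℤ.+-identityʳ (v zero) ⟩
  v zero       ∎
I·ᵥ {ℕ.suc n} v (suc i) = trans (ℤ.+-identityˡ _) (I·ᵥ (v ∘ suc) i)

•I·ᵥ : ∀ {n} c (v : Vector ℤ n) → (c • I n) ·ᵥ v ≗ c •ᵥ v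
•I·ᵥ {n} c v i = begin
  ∑[ j < n ] (c * I n i j * v j)    ≡⟨ sum-cong-≗ (λ j → ℤ.*-assoc c (I n i j) (v j)) ⟩
  ∑[ j < n ] (c * (I n i j * v j))  ≡⟨ *-distribˡ-sum c (λ j → I n i j * v j) ⟨
  c * (I n ·ᵥ v) i                  ≡⟨ cong (c *_) (I·ᵥ v i) ⟩
  c * v i                           ∎

∑-I : ∀ {n} (i : Fin n) → ∑[ j < n ] I n i j ≡ 1ℤ
∑-I {n} i = trans (sum-cong-≗ (λ j → sym (ℤ.*-identityʳ (I n i j)))) (I·ᵥ (𝟏 n) i)

·ᵥ-congˡ : ∀ {n} {A B : Matrix n} (v : Vector ℤ n) →
           (∀ i j → A i j ≡ B i j) → A ·ᵥ v ≗ B ·ᵥ v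
·ᵥ-congˡ v A≡B i = sum-cong-≗ (λ j → cong (_* v j) (A≡B i j))

·ᵥ-congʳ : ∀ {n} (A : Matrix n) {u v : Vector ℤ n} → u ≗ v → A ·ᵥ u ≗ A ·ᵥ v
·ᵥ-congʳ A u≡v i = sum-cong-≗ (λ j → cong (A i j *_) (u≡v j))

·ᵥ-assoc : ∀ {n} (A B : Matrix n) (v : Vector ℤ n) → (A · B) ·ᵥ v ≗ A ·ᵥ (B ·ᵥ v)
·ᵥ-assoc {n} A B v i = begin
  ∑[ j < n ] ((A · B) i j * v j)
    ≡⟨ sum-cong-≗ (λ j → *-distribʳ-sum (v j) (λ l → A i l * B l j)) ⟩
  ∑[ j < n ] ∑[ l < n ] (A i l * B l j * v j)
    ≡⟨ ∑-comm (λ j l → A i l * B l j * v j) ⟩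
  ∑[ l < n ] ∑[ j < n ] (A i l * B l j * v j)
    ≡⟨ sum-cong-≗ (λ l → sum-cong-≗ (λ j → ℤ.*-assoc (A i l) (B l j) (v j))) ⟩
  ∑[ l < n ] ∑[ j < n ] (A i l * (B l j * v j))
    ≡⟨ sum-cong-≗ (λ l → *-distribˡ-sum (A i l) (λ j → B l j * v j)) ⟨
  ∑[ l < n ] (A i l * (B ·ᵥ v) l)
    ∎

·ᵥ-adjoint : ∀ {n} (A : Matrix n) (u v : Vector ℤ n) →
             ∑[ i < n ] ((A ·ᵥ u) i * v i) ≡ ∑[ j < n ] (u j * (A ᵀ ·ᵥ v) j)
·ᵥ-adjoint {n} A u v = begin
  ∑[ i < n ] ((A ·ᵥ u) i * v i)
    ≡⟨ sum-cong-≗ (λ i → *-distribʳ-sum (v i) (λ j → A i j * u j)) ⟩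
  ∑[ i < n ] ∑[ j < n ] (A i j * u j * v i)
    ≡⟨ ∑-comm (λ i j → A i j * u j * v i) ⟩
  ∑[ j < n ] ∑[ i < n ] (A i j * u j * v i)
    ≡⟨ sum-cong-≗ (λ j → sum-cong-≗ (λ i → rotate (A i j) (u j) (v i))) ⟩
  ∑[ j < n ] ∑[ i < n ] (u j * (A i j * v i))
    ≡⟨ sum-cong-≗ (λ j → *-distribˡ-sum (u j) (λ i → A i j * v i)) ⟨
  ∑[ j < n ] (u j * (A ᵀ ·ᵥ v) j)
    ∎
  where
  rotate : ∀ a x y → a * x * y ≡ x * (a * y)
  rotate = solve-∀

-- With P = AᵀA one has P² = cP and tr P = cn, so the nonnegative number
-- ‖P - cI‖² = tr P² - 2c tr P + c² n vanishes.
module _ {n} (A : Matrix n) (c : ℤ) (AAᵀ≡cI : ∀ i j → (A · A ᵀ) i j ≡ (c • I n) i j) where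

  private
    P : Matrix n
    P = A ᵀ · A

    P-symmetric : ∀ i j → P i j ≡ P j i
    P-symmetric i j = sum-cong-≗ (λ l → ℤ.*-comm (A l i) (A l j))

    P²≡cP : ∀ i j → (P · P) i j ≡ c * P i j
    P²≡cP i j = begin
      -- Column `j` of `P` is `A ᵀ ·ᵥ aⱼ` by definition, so the product of matrices is already an
      -- iterated action on the vector `aⱼ`, with `A · A ᵀ` in the middle.
      (P ·ᵥ (A ᵀ ·ᵥ aⱼ)) i           ≡⟨ ·ᵥ-assoc (A ᵀ) A (A ᵀ ·ᵥ aⱼ) i ⟩
      (A ᵀ ·ᵥ (A ·ᵥ (A ᵀ ·ᵥ aⱼ))) i  ≡⟨ ·ᵥ-congʳ (A ᵀ) AAᵀaⱼ≡caⱼ i ⟩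
      (A ᵀ ·ᵥ (c •ᵥ aⱼ)) i           ≡⟨ sum-cong-≗ (λ l → pull (A l i) c (aⱼ l)) ⟩
      ∑[ l < n ] (c * (A l i * aⱼ l)) ≡⟨ *-distribˡ-sum c (λ l → A l i * aⱼ l) ⟨
      c * P i j                      ∎
      where
      aⱼ : Vector ℤ n
      aⱼ l = A l j
      AAᵀaⱼ≡caⱼ : A ·ᵥ (A ᵀ ·ᵥ aⱼ) ≗ c •ᵥ aⱼ
      AAᵀaⱼ≡caⱼ l = trans (sym (·ᵥ-assoc A (A ᵀ) aⱼ l))
                      (trans (·ᵥ-congˡ aⱼ AAᵀ≡cI l) (•I·ᵥ c aⱼ l))
      pull : ∀ a c x → a * (c * x) ≡ c * (a * x)
      pull = solve-∀

    trace : ∑[ j < n ] P j j ≡ ∑[ j < n ] c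
    trace = begin
      ∑[ j < n ] ∑[ l < n ] (A l j * A l j)  ≡⟨ ∑-comm (λ j l → A l j * A l j) ⟩
      ∑[ l < n ] (A · A ᵀ) l l               ≡⟨ sum-cong-≗ diagonal ⟩
      ∑[ l < n ] c                           ∎
      where
      diagonal : ∀ l → (A · A ᵀ) l l ≡ c
      diagonal l = trans (AAᵀ≡cI l l)
                     (trans (cong (c *_) (I-diagonal l)) (ℤ.*-identityʳ c))

    R : Matrix n
    R i j = P i j - c * I n i j

    row-norm : ∀ i → ∑[ j < n ] (R i j * R i j) ≡ c * (c - P i i)
    row-norm i = begin
      ∑[ j < n ] (R i j * R i j)
        -- A factor `I n i j` is pulled out of both the cross term and the last term, so that their
        -- sum is the identity matrix applied to `w` and collapses to `w i`. By symmetry of `P` the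
        -- remaining sum is the diagonal entry of `P · P`.
        ≡⟨ sum-cong-≗ (λ j → expand (P i j) c (I n i j)) ⟩
      ∑[ j < n ] (P i j * P i j - I n i j * w j)
        ≡⟨ ∑-distrib-- (λ j → P i j * P i j) (λ j → I n i j * w j) ⟩
      ∑[ j < n ] (P i j * P i j) - (I n ·ᵥ w) i
        ≡⟨ cong₂ _-_ (trans (sum-cong-≗ (λ j → cong (P i j *_) (P-symmetric i j)))
                            (P²≡cP i i))
                     (trans (I·ᵥ w i) (cong (λ δ → + 2 * c * P i i - c * c * δ) (I-diagonal i))) ⟩
      c * P i i - (+ 2 * c * P i i - c * c * 1ℤ)
        ≡⟨ collect c (P i i) ⟩
      c * (c - P i i)
        ∎
      where
      w : Vector ℤ n
      w j = + 2 * c * P i j - c * c * I n i j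
      expand : ∀ p c δ → (p - c * δ) * (p - c * δ) ≡ p * p - δ * (+ 2 * c * p - c * c * δ)
      expand = solve-∀
      collect : ∀ c p → c * p - (+ 2 * c * p - c * c * 1ℤ) ≡ c * (c - p)
      collect = solve-∀

    total : ∑[ i < n ] ∑[ j < n ] (R i j * R i j) ≡ 0ℤ
    total = begin
      ∑[ i < n ] ∑[ j < n ] (R i j * R i j)  ≡⟨ sum-cong-≗ row-norm ⟩
      ∑[ i < n ] (c * (c - P i i))           ≡⟨ *-distribˡ-sum c (λ i → c - P i i) ⟨
      c * ∑[ i < n ] (c - P i i)             ≡⟨ cong (c *_) (∑-distrib-- (λ _ → c) (λ i → P i i)) ⟩
      c * (∑[ i < n ] c - ∑[ i < n ] P i i)  ≡⟨ cong (c *_) (ℤ.i≡j⇒i-j≡0 (sym trace)) ⟩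
      c * 0ℤ                                 ≡⟨ ℤ.*-zeroʳ c ⟩
      0ℤ                                     ∎

  AᵀA≡cI : ∀ i j → (A ᵀ · A) i j ≡ (c • I n) i j
  AᵀA≡cI i j = ℤ.i-j≡0⇒i≡j (P i j) (c * I n i j) (square≡0⇒≡0 (R i j) R²≡0)
    where
    R²≡0 : R i j * R i j ≡ 0ℤ
    R²≡0 = ∑≡0⇒≡0 (λ j → square-nonNegative (R i j))
             (∑≡0⇒≡0 (λ i → ∑-nonNegative (λ j → square-nonNegative (R i j))) total i) j

  -- Moving `A` across the inner product produces `A ᵀ · A`, which is why the orthogonality of rows
  -- first had to be transferred to columns. At the all-one vector this gives the sum of the squared
  -- row sums.
  scaled-isometry : ∀ v → ∑[ i < n ] ((A ·ᵥ v) i * (A ·ᵥ v) i) ≡ c * ∑[ i < n ] (v i * v i)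
  scaled-isometry v = begin
    ∑[ i < n ] ((A ·ᵥ v) i * (A ·ᵥ v) i)     ≡⟨ ·ᵥ-adjoint A v (A ·ᵥ v) ⟩
    ∑[ j < n ] (v j * (A ᵀ ·ᵥ (A ·ᵥ v)) j)   ≡⟨ sum-cong-≗ (λ j → cong (v j *_) (AᵀAv≡cv j)) ⟩
    ∑[ j < n ] (v j * (c * v j))             ≡⟨ sum-cong-≗ (λ j → pull (v j) c) ⟩
    ∑[ j < n ] (c * (v j * v j))             ≡⟨ *-distribˡ-sum c (λ j → v j * v j) ⟨
    c * ∑[ j < n ] (v j * v j)               ∎
    where
    AᵀAv≡cv : A ᵀ ·ᵥ (A ·ᵥ v) ≗ c •ᵥ v
    AᵀAv≡cv j = trans (sym (·ᵥ-assoc (A ᵀ) A v j)) (trans (·ᵥ-congˡ v AᵀA≡cI j) (•I·ᵥ c v j))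
    pull : ∀ x c → x * (c * x) ≡ c * (x * x)
    pull = solve-∀

-- Parity

-- Modulo 2 an integer may be replaced by its square; every parity argument below rests on this.
-- Negative integers reduce to positive ones, as changing the sign of `x` changes the value by `2x`.
2∣x²-x : ∀ x → + 2 ∣ x * x - x
2∣x²-x (+ n)    = 2∣n²-n n
  where
  step : ∀ x → (1ℤ + x) * (1ℤ + x) - (1ℤ + x) ≡ (x * x - x) + x * + 2
  step = solve-∀
  2∣n²-n : ∀ n → + 2 ∣ + n * + n - + n
  2∣n²-n ℕ.zero    = divides 0ℤ refl
  2∣n²-n (ℕ.suc n) =
    subst (+ 2 ∣_) (sym (step (+ n))) (∣m∣n⇒∣m+n (2∣n²-n n) (divides (+ n) refl))
2∣x²-x -[1+ n ] = subst (+ 2 ∣_) (flip +[1+ n ])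
  (∣m∣n⇒∣m+n (2∣x²-x +[1+ n ]) (divides +[1+ n ] refl))
  where
  flip : ∀ x → (x * x - x) + x * + 2 ≡ (- x) * (- x) - (- x)
  flip = solve-∀

2∤1 : ¬ (+ 2 ∣ 1ℤ)
2∤1 = from-no (+ 2 ∣? 1ℤ)

odd⇒2∣k-1 : ∀ {k} → Odd k → + 2 ∣ k - 1ℤ
odd⇒2∣k-1 (j , refl) = divides j (cancel j)
  where
  cancel : ∀ j → + 2 * j + 1ℤ - 1ℤ ≡ j * + 2
  cancel = solve-∀

-- The strict upper bound on the root leaves `k` at least -1, and -1 would force `n - 1 < 1`.
-- Oddness excludes 0.
odd-positive : ∀ {n k} → 2 ℕ.≤ n → Odd k → √ (+ n - 1ℤ) < k + + 2 → 0ℤ < k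
odd-positive {k = + ℕ.zero}            _ k-odd _ =
  contradiction (∣m∣n⇒∣m-n (divides 0ℤ refl) (odd⇒2∣k-1 k-odd)) 2∤1
odd-positive {k = +[1+ _ ]}            _ _ _ = +<+ (ℕ.s≤s ℕ.z≤n)
odd-positive {k = -[1+ ℕ.zero ]}       (ℕ.s≤s (ℕ.s≤s _)) _ (_ , +<+ (ℕ.s≤s ()))
odd-positive {k = -[1+ ℕ.suc ℕ.zero ]}    _ _ (+<+ () , _)
odd-positive {k = -[1+ ℕ.suc (ℕ.suc _) ]} _ _ (() , _)

-- The product is negative only strictly between 0 and 2, where there is no even integer. The cases
-- are the quotients 0, 1, at least 2, and negative.
2∣x⇒0≤x[x-2] : ∀ {x} → + 2 ∣ x → 0ℤ ≤ x * (x - + 2)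
2∣x⇒0≤x[x-2] (divides (+ ℕ.zero) refl)     = ℤ.≤-refl
2∣x⇒0≤x[x-2] (divides +[1+ ℕ.zero ] refl)  = ℤ.≤-refl
2∣x⇒0≤x[x-2] (divides +[1+ ℕ.suc _ ] refl) = +≤+ ℕ.z≤n
2∣x⇒0≤x[x-2] (divides -[1+ _ ] refl)       = +≤+ ℕ.z≤n

-- Row sums of a conference matrix and the parity of its order

module Conference {n} {W : Matrix n} (conf : IsConference W) where
  open IsConference conf

  rowSum : Vector ℤ n
  rowSum = W ·ᵥ 𝟏 n

  excess≡∑rowSum : excess W ≡ sum rowSum
  excess≡∑rowSum = sum-cong-≗ (λ i → sum-cong-≗ (λ j → sym (ℤ.*-identityʳ (W i j))))

  ∑rowSum² : ∑[ i < n ] (rowSum i * rowSum i) ≡ + n * (+ n - 1ℤ)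
  ∑rowSum² = begin
    ∑[ i < n ] (rowSum i * rowSum i)  ≡⟨ scaled-isometry W (+ n - 1ℤ) orthogonal (𝟏 n) ⟩
    (+ n - 1ℤ) * ∑[ i < n ] 1ℤ        ≡⟨ cong ((+ n - 1ℤ) *_) (∑-const n 1ℤ) ⟩
    (+ n - 1ℤ) * (+ n * 1ℤ)           ≡⟨ swap (+ n) (+ n - 1ℤ) ⟩
    + n * (+ n - 1ℤ)                  ∎
    where
    swap : ∀ x c → c * (x * 1ℤ) ≡ x * c
    swap = solve-∀

  row-norm : ∀ i → ∑[ j < n ] (W i j * W i j) ≡ + n - 1ℤ
  row-norm i = trans (orthogonal i i)
                 (trans (cong ((+ n - 1ℤ) *_) (I-diagonal i)) (ℤ.*-identityʳ _))

  -- The entry condition alone permits zeros off the diagonal. Each such zero would lower the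
  -- squared norm of its row, but that norm is `n - 1`, the largest value compatible with the zero
  -- on the diagonal.
  offDiagonal-square : ∀ i j → W i j * W i j ≡ 1ℤ - I n i j
  offDiagonal-square i j =
    sym (ℤ.i-j≡0⇒i≡j (1ℤ - I n i j) (W i j * W i j) (∑≡0⇒≡0 defect≥0 ∑defect≡0 j))
    where
    defect : Vector ℤ n
    defect j = (1ℤ - I n i j) - W i j * W i j

    defect≥0 : ∀ j → 0ℤ ≤ defect j
    defect≥0 j with i ≟ j
    ... | yes refl rewrite zeroDiagonal i = ℤ.≤-refl
    ... | no _ with W i j | entries i j
    -- An off-diagonal zero has defect 1. It is not contradictory here; the vanishing sum of the
    -- defects excludes it.
    ...   | _ | inj₁ refl        = +≤+ ℕ.z≤n
    ...   | _ | inj₂ (inj₁ refl) = ℤ.≤-refl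
    ...   | _ | inj₂ (inj₂ refl) = ℤ.≤-refl

    ∑defect≡0 : sum defect ≡ 0ℤ
    ∑defect≡0 = begin
      sum defect
        ≡⟨ ∑-distrib-- (λ j → 1ℤ - I n i j) (λ j → W i j * W i j) ⟩
      ∑[ j < n ] (1ℤ - I n i j) - ∑[ j < n ] (W i j * W i j)
        ≡⟨ cong₂ _-_ (∑-distrib-- (𝟏 n) (I n i)) (row-norm i) ⟩
      (∑[ j < n ] 1ℤ - ∑[ j < n ] I n i j) - (+ n - 1ℤ)
        ≡⟨ cong₂ (λ x y → (x - y) - (+ n - 1ℤ)) (∑-const n 1ℤ) (∑-I i) ⟩
      (+ n * 1ℤ - 1ℤ) - (+ n - 1ℤ)
        ≡⟨ cancel (+ n) ⟩
      0ℤ ∎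
      where
      cancel : ∀ x → (x * 1ℤ - 1ℤ) - (x - 1ℤ) ≡ 0ℤ
      cancel = solve-∀

  -- Modulo 2 the inner product of rows i and j counts the columns other than i and j.
  order-even : ∀ {i j} → I n i j ≡ 0ℤ → + 2 ∣ + n
  order-even {i} {j} Iij≡0 =
    subst (+ 2 ∣_) value (∣m∣n⇒∣m+n (∣-∑ even) (divides 1ℤ refl))
    where
    δ ε : Vector ℤ n
    δ = I n i
    ε = I n j

    -- With `x = W i l * W j l`, the first product is `x * x`, so the summand is `x * x - x`.
    even : ∀ l → + 2 ∣ (1ℤ - δ l) * (1ℤ - ε l) - W i l * W j l
    even l = subst (λ x → + 2 ∣ x - W i l * W j l)
      (trans (regroup (W i l) (W j l)) (cong₂ _*_ (offDiagonal-square i l) (offDiagonal-square j l)))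
      (2∣x²-x (W i l * W j l))
      where
      regroup : ∀ a b → (a * b) * (a * b) ≡ (a * a) * (b * b)
      regroup = solve-∀

    value : ∑[ l < n ] ((1ℤ - δ l) * (1ℤ - ε l) - W i l * W j l) + + 2 ≡ + n
    value = begin
      ∑[ l < n ] ((1ℤ - δ l) * (1ℤ - ε l) - W i l * W j l) + + 2
        ≡⟨ cong (_+ + 2) (∑-distrib-- (λ l → (1ℤ - δ l) * (1ℤ - ε l)) (λ l → W i l * W j l)) ⟩
      (∑[ l < n ] ((1ℤ - δ l) * (1ℤ - ε l)) - (W · W ᵀ) i j) + + 2
        ≡⟨ cong₂ (λ x y → (x - y) + + 2) complement (trans (orthogonal i j) (cong ((+ n - 1ℤ) *_) Iij≡0)) ⟩
      ((+ n * 1ℤ - 1ℤ) - (1ℤ - 0ℤ) - (+ n - 1ℤ) * 0ℤ) + + 2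
        ≡⟨ cancel (+ n) ⟩
      + n ∎
      where
      cancel : ∀ x → ((x * 1ℤ - 1ℤ) - (1ℤ - 0ℤ) - (x - 1ℤ) * 0ℤ) + + 2 ≡ x
      cancel = solve-∀
      expand : ∀ x y → (1ℤ - x) * (1ℤ - y) ≡ (1ℤ - x) - (y - x * y)
      expand = solve-∀
      -- The sum of `δ l * ε l` is entry `i` of the identity matrix applied to `ε`, which is 0 for
      -- distinct rows. Hence the total is `n - 2`, and the `+ 2` in `value` restores `n`.
      complement : ∑[ l < n ] ((1ℤ - δ l) * (1ℤ - ε l)) ≡ (+ n * 1ℤ - 1ℤ) - (1ℤ - 0ℤ)
      complement = begin
        ∑[ l < n ] ((1ℤ - δ l) * (1ℤ - ε l))
          ≡⟨ sum-cong-≗ (λ l → expand (δ l) (ε l)) ⟩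
        ∑[ l < n ] ((1ℤ - δ l) - (ε l - δ l * ε l))
          ≡⟨ ∑-distrib-- (λ l → 1ℤ - δ l) (λ l → ε l - δ l * ε l) ⟩
        ∑[ l < n ] (1ℤ - δ l) - ∑[ l < n ] (ε l - δ l * ε l)
          ≡⟨ cong₂ _-_ (∑-distrib-- (𝟏 n) δ) (∑-distrib-- ε (λ l → δ l * ε l)) ⟩
        (∑[ l < n ] 1ℤ - sum δ) - (sum ε - (I n ·ᵥ ε) i)
          ≡⟨ cong₂ _-_ (cong₂ _-_ (∑-const n 1ℤ) (∑-I i))
                       (cong₂ _-_ (∑-I j) (trans (I·ᵥ ε i) (trans (I-symmetric j i) Iij≡0))) ⟩
        (+ n * 1ℤ - 1ℤ) - (1ℤ - 0ℤ)
          ∎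

  -- Replacing each entry by its square preserves parity, and the squares of a row add up to
  -- `n - 1`.
  rowSum-parity : ∀ i → + 2 ∣ (+ n - 1ℤ) - rowSum i
  rowSum-parity i = subst (+ 2 ∣_) value
    (∣-∑ (λ j → subst (λ x → + 2 ∣ W i j * W i j - x) (sym (ℤ.*-identityʳ (W i j))) (2∣x²-x (W i j))))
    where
    value : ∑[ j < n ] (W i j * W i j - W i j * 1ℤ) ≡ (+ n - 1ℤ) - rowSum i
    value = trans (∑-distrib-- (λ j → W i j * W i j) (λ j → W i j * 1ℤ))
                  (cong (_- rowSum i) (row-norm i))

order-even : ∀ {n} {W : Matrix n} → 2 ℕ.≤ n → IsConference W → + 2 ∣ + n
order-even (ℕ.s≤s (ℕ.s≤s _)) conf = Conference.order-even conf {zero} {suc zero} refl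

-- Comparison with the rational bound

-- Both denominators are 1, so the rational product unfolds to the numerator `x * y` over the
-- denominator 1, in the form that `↥p/↧p≡p` normalises.
fromℤ-* : ∀ x y → fromℤ x ℚ.* fromℤ y ≡ fromℤ (x * y)
fromℤ-* x y = ℚ.↥p/↧p≡p (fromℤ (x * y))

fromℤ-mono-≤ : ∀ {x y} → x ≤ y → fromℤ x ℚ.≤ fromℤ y
fromℤ-mono-≤ {x} {y} x≤y = ℚ.*≤* (subst₂ _≤_ (sym (ℤ.*-identityʳ x)) (sym (ℤ.*-identityʳ y)) x≤y)

÷-*-cancel : ∀ p q .{{_ : ℚ.NonZero q}} → (p ℚ.÷ q) ℚ.* q ≡ p
÷-*-cancel p q =
  trans (ℚ.*-assoc p (ℚ.1/ q) q) (trans (cong (p ℚ.*_) (ℚ.*-inverseˡ q)) (ℚ.*-identityʳ p))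

*-÷-cancel : ∀ p q .{{_ : ℚ.NonZero q}} → (p ℚ.* q) ℚ.÷ q ≡ p
*-÷-cancel p q =
  trans (ℚ.*-assoc p q (ℚ.1/ q)) (trans (cong (p ℚ.*_) (ℚ.*-inverseʳ q)) (ℚ.*-identityʳ p))

fromℤ-≤-÷ : ∀ x a d .{{_ : Positive d}} .{{_ : ℚ.NonZero (fromℤ d)}} →
            x * d ≤ a → fromℤ x ℚ.≤ fromℤ a ℚ.÷ fromℤ d
-- Exposing the constructor of `d` lets positivity of `fromℤ d` be found by computation.
fromℤ-≤-÷ x a d@(+[1+ _ ]) xd≤a = ℚ.*-cancelʳ-≤-pos (fromℤ d)
  (subst₂ ℚ._≤_ (sym (fromℤ-* x d)) (sym (÷-*-cancel (fromℤ a) (fromℤ d))) (fromℤ-mono-≤ xd≤a))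

fromℤ-≡-÷ : ∀ x a d .{{_ : ℚ.NonZero (fromℤ d)}} →
            (fromℤ x ≡ fromℤ a ℚ.÷ fromℤ d) ⇔ (x * d ≡ a)
fromℤ-≡-÷ x a d = mk⇔
  (λ x≡a/d → cong ℚ.ℚ.numerator
     (trans (sym (fromℤ-* x d))
            (trans (cong (ℚ._* fromℤ d) x≡a/d) (÷-*-cancel (fromℤ a) (fromℤ d)))))
  (λ xd≡a → trans (sym (*-÷-cancel (fromℤ x) (fromℤ d)))
     (cong (λ p → p ℚ.÷ fromℤ d) (trans (fromℤ-* x d) (cong fromℤ xd≡a))))

-- The gap between the two sides

module _ {n} (s : Vector ℤ n) (k : ℤ) where

  gap : Vector ℤ n
  gap i = (s i - k) * (s i - k - + 2)

  gap≥0 : (∀ i → + 2 ∣ s i - k) → ∀ i → 0ℤ ≤ gap i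
  gap≥0 2∣s-k i = 2∣x⇒0≤x[x-2] (2∣s-k i)

  gap≡0⇔ : ∀ i → (gap i ≡ 0ℤ) ⇔ (s i ≡ k ⊎ s i ≡ k + + 2)
  gap≡0⇔ i = mk⇔ to from
    where
    shift : ∀ x k → x - k - + 2 ≡ x - (k + + 2)
    shift = solve-∀
    to : gap i ≡ 0ℤ → s i ≡ k ⊎ s i ≡ k + + 2
    to g with ℤ.i*j≡0⇒i≡0∨j≡0 (s i - k) g
    ... | inj₁ p = inj₁ (ℤ.i-j≡0⇒i≡j (s i) k p)
    ... | inj₂ p = inj₂ (ℤ.i-j≡0⇒i≡j (s i) (k + + 2) (trans (sym (shift (s i) k)) p))
    from : s i ≡ k ⊎ s i ≡ k + + 2 → gap i ≡ 0ℤ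
    from (inj₁ p) = cong (_* (s i - k - + 2)) (ℤ.i≡j⇒i-j≡0 p)
    from (inj₂ p) = trans (cong ((s i - k) *_) (trans (shift (s i) k) (ℤ.i≡j⇒i-j≡0 p)))
                          (ℤ.*-zeroʳ (s i - k))

  -- Expanding a gap gives a square, a constant and a multiple of `s i`. The squares have a
  -- prescribed sum, so only the linear term still depends on `s`; its coefficient is the
  -- denominator of the bound.
  ∑gap : ∑[ i < n ] (s i * s i) ≡ + n * (+ n - 1ℤ) →
         sum gap ≡ + n * (k * k + + 2 * k + + n - 1ℤ) - sum s * (+ 2 * (k + 1ℤ))
  ∑gap ∑s² = begin
    sum gap
      ≡⟨ sum-cong-≗ (λ i → expand (s i) k) ⟩
    ∑[ i < n ] (s i * s i + k * (k + + 2) - s i * d)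
      ≡⟨ ∑-distrib-- (λ i → s i * s i + k * (k + + 2)) (λ i → s i * d) ⟩
    ∑[ i < n ] (s i * s i + k * (k + + 2)) - ∑[ i < n ] (s i * d)
      ≡⟨ cong₂ _-_ (∑-distrib-+ (λ i → s i * s i) (λ _ → k * (k + + 2))) (sym (*-distribʳ-sum d s)) ⟩
    ∑[ i < n ] (s i * s i) + ∑[ i < n ] (k * (k + + 2)) - sum s * d
      ≡⟨ cong (_- sum s * d) (trans (cong₂ _+_ ∑s² (∑-const n (k * (k + + 2)))) (collect (+ n) k)) ⟩
    + n * (k * k + + 2 * k + + n - 1ℤ) - sum s * d
      ∎
    where
    d = + 2 * (k + 1ℤ)
    expand : ∀ x k → (x - k) * (x - k - + 2) ≡ x * x + k * (k + + 2) - x * (+ 2 * (k + 1ℤ))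
    expand = solve-∀
    collect : ∀ n k → n * (n - 1ℤ) + n * (k * (k + + 2)) ≡ n * (k * k + + 2 * k + n - 1ℤ)
    collect = solve-∀

-- The two equality cases

-- The difference of squares factors as `(y - x) * (y + x)`, and the positive factor `y + x`
-- cancels.
square-cancel-≤ : ∀ {x y} → 0ℤ < x → 0ℤ ≤ y → x * x ≤ y * y → x ≤ y
square-cancel-≤ {x} {y} x>0 y≥0 x²≤y² =
  ℤ.0≤i-j⇒j≤i (ℤ.*-cancelʳ-≤-pos 0ℤ (y - x) (y + x) {{positive (ℤ.+-mono-≤-< y≥0 x>0)}}
    (subst (0ℤ ≤_) (factor y x) (ℤ.i≤j⇒0≤j-i x²≤y²)))
  where
  factor : ∀ y x → y * y - x * x ≡ (y - x) * (y + x)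
  factor = solve-∀

square-cancel-< : ∀ {x y} → 0ℤ ≤ y → x * x < y * y → x < y
square-cancel-< {x} {y} y≥0 x²<y² =
  ℤ.≰⇒> λ y≤x → ℤ.<⇒≱ x²<y²
    (ℤ.≤-trans (ℤ.*-monoˡ-≤-nonNeg y {{nonNegative y≥0}} y≤x)
               (ℤ.*-monoʳ-≤-nonNeg x {{nonNegative (ℤ.≤-trans y≥0 y≤x)}} y≤x))

∣-∣-square : ∀ x → + ∣ x ∣ * + ∣ x ∣ ≡ x * x
∣-∣-square (+ _)    = refl
∣-∣-square -[1+ _ ] = refl

even∧0≤x<2⇒x≡0 : ∀ {x} → + 2 ∣ x → 0ℤ ≤ x → x < + 2 → x ≡ 0ℤ
even∧0≤x<2⇒x≡0 {+ 0} _   _ _ = refl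
even∧0≤x<2⇒x≡0 {+ 1} 2∣1 _ _ = contradiction 2∣1 2∤1
even∧0≤x<2⇒x≡0 {+ ℕ.suc (ℕ.suc _)} _ _ (+<+ (ℕ.s≤s (ℕ.s≤s ())))

-- A nonnegative root `a` of `c` satisfies `k ≤ a < k + 2`. As `a` has the parity of its square,
-- which is that of `k`, the candidate `k + 1` drops out.
square-between : ∀ {k c} → 0ℤ < k → + 2 ∣ c - k → k * k ≤ c → c < (k + + 2) * (k + + 2) →
                 PerfectSquare c → c ≡ k * k
square-between {k} {c} k>0 2∣c-k k²≤c c<[k+2]² (r , c≡r²) = trans c≡a² (cong (λ x → x * x) a≡k)
  where
  a : ℤ
  -- The given root may be negative, while comparing roots through their squares requires a
  -- nonnegative one.
  a = + ∣ r ∣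
  c≡a² : c ≡ a * a
  c≡a² = trans c≡r² (sym (∣-∣-square r))
  k≤a : k ≤ a
  k≤a = square-cancel-≤ k>0 (+≤+ ℕ.z≤n) (subst (k * k ≤_) c≡a² k²≤c)
  a<k+2 : a < k + + 2
  a<k+2 = square-cancel-< (ℤ.+-mono-≤ (ℤ.<⇒≤ k>0) (+≤+ ℕ.z≤n)) (subst (_< (k + + 2) * (k + + 2)) c≡a² c<[k+2]²)
  difference : ∀ a k → (a * a - k) - (a * a - a) ≡ a - k
  difference = solve-∀
  2∣a-k : + 2 ∣ a - k
  2∣a-k = subst (+ 2 ∣_) (difference a k)
            (∣m∣n⇒∣m-n (subst (λ x → + 2 ∣ x - k) c≡a² 2∣c-k) (2∣x²-x a))
  recover : ∀ k → (k + + 2) - k ≡ + 2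
  recover = solve-∀
  a≡k : a ≡ k
  a≡k = ℤ.i-j≡0⇒i≡j a k (even∧0≤x<2⇒x≡0 2∣a-k (ℤ.i≤j⇒0≤j-i k≤a)
          (subst (a - k <_) (recover k) (ℤ.+-monoˡ-< (- k) a<k+2)))

module _ {n} (n≥2 : 2 ℕ.≤ n) (s : Vector ℤ n) (k c : ℤ) (∑s² : ∑[ i < n ] (s i * s i) ≡ + n * c)
         (k>0 : 0ℤ < k) (2∣c-k : + 2 ∣ c - k) (k²≤c : k * k ≤ c) (c<[k+2]² : c < (k + + 2) * (k + + 2)) where

  private
    constant⇒square : ∀ x → (∀ i → s i ≡ x) → c ≡ x * x
    constant⇒square x s≡x = cancel n≥2 (begin
      + n * c                 ≡⟨ ∑s² ⟨
      ∑[ i < n ] (s i * s i)  ≡⟨ sum-cong-≗ (λ i → cong₂ _*_ (s≡x i) (s≡x i)) ⟩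
      ∑[ i < n ] (x * x)      ≡⟨ ∑-const n (x * x) ⟩
      + n * (x * x)           ∎)
      where
      cancel : ∀ {n} → 2 ℕ.≤ n → + n * c ≡ + n * (x * x) → c ≡ x * x
      cancel {ℕ.suc n} _ = ℤ.*-cancelˡ-≡ +[1+ n ] c (x * x)

  twoValued⇔ : (∀ i → s i ≡ k ⊎ s i ≡ k + + 2) ⇔
               ((PerfectSquare c × s ≗ k •ᵥ 𝟏 n)
                ⊎ (¬ PerfectSquare c × (Entries s ≐ ｛ k ｝ ∪ ｛ k + + 2 ｝)))
  twoValued⇔ = mk⇔ to from
    where
    from : _ → ∀ i → s i ≡ k ⊎ s i ≡ k + + 2
    from (inj₁ (_ , s≡k))           i = inj₁ (trans (s≡k i) (ℤ.*-identityʳ k))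
    from (inj₂ (_ , (entries⊆ , _))) i with entries⊆ (i , refl)
    ... | inj₁ k≡s   = inj₁ (sym k≡s)
    ... | inj₂ k+2≡s = inj₂ (sym k+2≡s)

    module _ (two : ∀ i → s i ≡ k ⊎ s i ≡ k + + 2) where

      -- Every square `s j * s j` is at least `k * k`, and their sum is `n` times `k * k`, so all of
      -- them equal `k * k`. A value `k + 2` would then make `c` equal to `(k + 2)²`, against the
      -- strict upper bound.
      all-k : c ≡ k * k → ∀ i → s i ≡ k
      all-k c≡k² i with two i
      ... | inj₁ s≡k   = s≡k
      ... | inj₂ s≡k+2 = contradiction c<[k+2]² (ℤ.<-irrefl (begin
          c                      ≡⟨ c≡k² ⟩
          k * k                  ≡⟨ ℤ.i-j≡0⇒i≡j (s i * s i) (k * k) (∑≡0⇒≡0 excess≥0 ∑excess≡0 i) ⟨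
          s i * s i              ≡⟨ cong₂ _*_ s≡k+2 s≡k+2 ⟩
          (k + + 2) * (k + + 2)  ∎))
        where
        [k+2]²≥k² : k * k ≤ (k + + 2) * (k + + 2)
        [k+2]²≥k² = ℤ.≤-trans k²≤c (ℤ.<⇒≤ c<[k+2]²)
        excess≥0 : ∀ j → 0ℤ ≤ s j * s j - k * k
        excess≥0 j with two j
        ... | inj₁ p rewrite p = ℤ.i≤j⇒0≤j-i (ℤ.≤-refl {k * k})
        ... | inj₂ p rewrite p = ℤ.i≤j⇒0≤j-i [k+2]²≥k²
        ∑excess≡0 : ∑[ j < n ] (s j * s j - k * k) ≡ 0ℤ
        ∑excess≡0 = begin
          ∑[ j < n ] (s j * s j - k * k)               ≡⟨ ∑-distrib-- (λ j → s j * s j) (λ _ → k * k) ⟩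
          ∑[ j < n ] (s j * s j) - ∑[ j < n ] (k * k)  ≡⟨ cong₂ _-_ ∑s² (∑-const n (k * k)) ⟩
          + n * c - + n * (k * k)                      ≡⟨ ℤ.i≡j⇒i-j≡0 (cong (+ n *_) c≡k²) ⟩
          0ℤ                                           ∎

      -- Otherwise `s` is constantly `k + 2`, which forces `c` to be `(k + 2)²`, just outside the
      -- allowed interval.
      k-occurs : k ∈ Entries s
      k-occurs with any? (λ i → s i ℤ.≟ k)
      ... | yes found = found
      ... | no  none  = contradiction c<[k+2]² (ℤ.<-irrefl (constant⇒square (k + + 2)
                          (λ i → [ (λ s≡k → contradiction (i , s≡k) none) , id ]′ (two i))))

      k+2-occurs : c ≢ k * k → k + + 2 ∈ Entries s
      k+2-occurs c≢k² with any? (λ i → s i ℤ.≟ (k + + 2))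
      ... | yes found = found
      ... | no  none  = contradiction (constant⇒square k
                          (λ i → [ id , (λ s≡k+2 → contradiction (i , s≡k+2) none) ]′ (two i))) c≢k²

      to : _
      -- Being a perfect square is decided by comparison with `k * k`, since `square-between` leaves
      -- no other square.
      to with c ℤ.≟ k * k
      ... | yes c≡k² = inj₁ ((k , c≡k²) , λ i → trans (all-k c≡k² i) (sym (ℤ.*-identityʳ k)))
      ... | no  c≢k² = inj₂ ((λ sq → c≢k² (square-between k>0 2∣c-k k²≤c c<[k+2]² sq))
                            , (λ { (i , refl) → [ inj₁ ∘ sym , inj₂ ∘ sym ]′ (two i) })
                            , λ { (inj₁ refl) → k-occurs ; (inj₂ refl) → k+2-occurs c≢k² })

proposition1p1 :
    (n : ℕ) (n≥2 : 2 ℕ.≤ n) (W : Matrix n) → IsConference W →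
    (k : ℤ) → Odd k → k ≤√ (+ n - 1ℤ) → (√n-1<k+2 : √ (+ n - 1ℤ) < k + + 2) →
    let bound : ℚ
        bound = ℚ._÷_ (fromℤ (+ n * (k * k + + 2 * k + + n - 1ℤ)))
                      (fromℤ (+ 2 * (k + 1ℤ)))
                      {{denominator-nonZero {n} {k} n≥2 √n-1<k+2}}
    in (fromℤ (excess W) ℚ.≤ bound)
       × ((fromℤ (excess W) ≡ bound)
          ⇔ ((PerfectSquare (+ n - 1ℤ) × (W ·ᵥ 𝟏 n ≗ k •ᵥ 𝟏 n))
             ⊎ (¬ PerfectSquare (+ n - 1ℤ) × (Entries (W ·ᵥ 𝟏 n) ≐ ｛ k ｝ ∪ ｛ k + + 2 ｝))))
proposition1p1 n n≥2 W conf k k-odd k≤√ √n-1<k+2 =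
    fromℤ-≤-÷ (excess W) N D {{D>0}} {{nz}} (ℤ.0≤i-j⇒j≤i (subst (0ℤ ≤_) ∑gap≡N-ED (∑-nonNegative gaps≥0)))
  -- The composite reads from right to left: clear the denominator, pass to vanishing gaps and so to
  -- two values, then separate the cases.
  , (twoValued⇔ n≥2 s k (+ n - 1ℤ) ∑rowSum² k>0 2∣c-k k²≤c (proj₂ √n-1<k+2) ⇔-∘ equality⇔twoValued)
      ⇔-∘ fromℤ-≡-÷ (excess W) N D {{nz}}
  where
  open Conference conf using (excess≡∑rowSum; ∑rowSum²; rowSum-parity) renaming (rowSum to s)

  N D : ℤ
  N = + n * (k * k + + 2 * k + + n - 1ℤ)
  D = + 2 * (k + 1ℤ)

  nz : ℚ.NonZero (fromℤ D)
  nz = denominator-nonZero {n} {k} n≥2 √n-1<k+2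

  k>0 : 0ℤ < k
  k>0 = odd-positive n≥2 k-odd √n-1<k+2

  D>0 : Positive D
  D>0 = positive (ℤ.*-monoˡ-<-pos (+ 2) (ℤ.+-mono-<-≤ k>0 (+≤+ {0} {1} ℕ.z≤n)))

  k²≤c : k * k ≤ + n - 1ℤ
  -- Positivity of `k` rules out the nonpositive alternative of `≤√`.
  k²≤c = [ (λ k≤0 → contradiction k>0 (ℤ.≤⇒≯ k≤0)) , id ]′ k≤√

  2∣c-k : + 2 ∣ (+ n - 1ℤ) - k
  2∣c-k = subst (+ 2 ∣_) (regroup (+ n) k)
            (∣m∣n⇒∣m-n (∣m∣n⇒∣m-n (order-even n≥2 conf) (odd⇒2∣k-1 k-odd)) (divides 1ℤ refl))
    where
    regroup : ∀ x k → (x - (k - 1ℤ)) - + 2 ≡ (x - 1ℤ) - k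
    regroup = solve-∀

  gaps≥0 : ∀ i → 0ℤ ≤ gap s k i
  -- With `c = n - 1`, both `c - k` and `c - s i` are even, hence so is their difference `s i - k`.
  gaps≥0 = gap≥0 s k λ i → subst (+ 2 ∣_) (cancel (+ n - 1ℤ) k (s i)) (∣m∣n⇒∣m-n 2∣c-k (rowSum-parity i))
    where
    cancel : ∀ c k x → (c - k) - (c - x) ≡ x - k
    cancel = solve-∀

  ∑gap≡N-ED : sum (gap s k) ≡ N - excess W * D
  ∑gap≡N-ED = trans (∑gap s k ∑rowSum²) (cong (λ e → N - e * D) (sym excess≡∑rowSum))

  equality⇔twoValued : (excess W * D ≡ N) ⇔ (∀ i → s i ≡ k ⊎ s i ≡ k + + 2)
  equality⇔twoValued = mk⇔
    (λ ED≡N i → Equivalence.to (gap≡0⇔ s k i)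
       (∑≡0⇒≡0 gaps≥0 (trans ∑gap≡N-ED (ℤ.i≡j⇒i-j≡0 (sym ED≡N))) i))
    (λ two → sym (ℤ.i-j≡0⇒i≡j N (excess W * D) (trans (sym ∑gap≡N-ED)
       (trans (sum-cong-≗ (λ i → Equivalence.from (gap≡0⇔ s k i) (two i))) (sum-replicate-zero n)))))
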